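{- Let $\rho_1,\rho_2$ be finite timed words over a finite set of propositions $\Sigma$, let $i_1\in dom(\rho_1)$, $j_1\in dom(\rho_2)$, let $r,k$ be nonnegative integers and let $I_\nu$ be a set of permissible intervals. Then $$(\rho_1,i_1)\approx_{r,k,I_\nu}(\rho_2,j_1)\quad\text{if and only if}\quad(\rho_1,i_1)\equiv^{\mathsf{CTMTL}}_{r,k,I_\nu}(\rho_2,j_1).$$
   Context: Timed words. A finite timed word over $\Sigma$ is $\rho=(\sigma,\tau)$ with $\sigma=\sigma_1\cdots\sigma_n$, $\tau=t_1\cdots t_n$, $\sigma_i\in 2^\Sigma\setminus\{\emptyset\}$, $t_i\in\mathbb{R}_{\ge 0}$, $t_i\le t_{i+1}$; $dom(\rho)=\{1,\dots,n\}$. Intervals are open, half-open or closed with endpoints in $\mathbb{N}\cup\{0,\infty\}$; $t+\langle a,b\rangle=\langle t+a,t+b\rangle$. $\mathsf{CTMTL}$ syntax: $\varphi ::= a\in\Sigma \mid true \mid \varphi\wedge\varphi \mid \neg\varphi \mid \mathsf{C}_I^{\ge n}\varphi \mid \varphi\,\mathsf{U}_{I,\eta}\,\varphi$, with $n\in\mathbb{N}\cup\{0\}$ and $\eta$ a threshold formula $\#\varphi\ge n$ or $\#\varphi<n$. Semantics: $\rho,i\models a$ iff $a\in\sigma_i$; booleans as usual; $\rho,i\models \mathsf{C}_I^{\ge n}\varphi$ iff $|\{k\in dom(\rho): t_k\in t_i+I,\ \rho,k\models\varphi\}|\ge n$; $\rho,i\models\varphi_1\mathsf{U}_{I,\#\varphi\ge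 n}\varphi_2$ iff there is $j>i$ with $\rho,j\models\varphi_2$, $t_j-t_i\in I$, $\rho,k\models\varphi_1$ for all $i<k<j$, and $|\{k: i<k<j,\ \rho,k\models\varphi\}|\ge n$; similarly for $\#\varphi<n$. Boolean combinations of threshold formulae are also regarded as expressible in $\mathsf{CTMTL}$. Depth (maximum nesting of $\mathsf{C}$, $\mathsf{UT}$ operators): $depth(a)=0$ for $a\in\Sigma$ (likewise $true$), $depth(\neg\varphi)=depth(\varphi)$, $depth(\varphi\wedge\psi)=\max(depth(\varphi),depth(\psi))$, $depth(\mathsf{C}_I^{\ge n}\varphi)=depth(\varphi)+1$, $depth(\varphi_1\mathsf{U}_{I,\#\varphi_3\sim n}\varphi_2)=\max(depth(\varphi_1),depth(\varphi_2),depth(\varphi_3))+1$. Formula equivalence: $(\rho_1,i_1)\equiv^{\mathsf{CTMTL}}_{r,k,I_\nu}(\rho_2,j_1)$ iff for every $\mathsf{CTMTL}$ formula $\varphi$ with intervals in $I_\nu$, of depth $\le r$, and with maximal counting constant $\le k$ in the $\mathsf{C}$ and $\mathsf{UT}$ modalities, $\rho_1,i_1\models\varphi\iff\rho_2,j_1\models\varphi$. Game. The $r$-round $k$-counting-pebble $I_\nu$ $\mathsf{CTMTL}$ game on $(\rho_1,\rho_2)$ is played by Spoiler and Duplicator. A configuration is a pair $(i,j)$, $i\in dom(\rho_1)$, $j\in dom(\rho_2)$; it is partially isomorphic, $isop(i,j)$, iff the sets of propositions at position $i$ of $\rho_1$ and position $j$ of $\rho_2$ are equal. The 0-round game from $(i,j)$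 is won by Duplicator iff $isop(i,j)$. In an $r$-round game ($r\ge1$) from $(i,j)$: if $isop(i,j)$ fails, Spoiler wins. Otherwise one round is played as follows and, if Spoiler has not won, the game continues with $r-1$ rounds from the new configuration. Duplicator wins iff he wins all rounds. In a round, Spoiler chooses one of the words $\rho_x$, $x\in\{1,2\}$; Duplicator plays on the other word $\rho_y$. Let $p_x,p_y$ be the current positions in $\rho_x,\rho_y$. Spoiler chooses one of two kinds of round, together with an interval $I\in I_\nu$ and a number $c\le k$ of pebbles. (1) $\mathsf{U}_{I,\eta}$ round. Spoiler chooses $p'_x>p_x$ in $\rho_x$ whose time difference from $p_x$ lies in $I$. Duplicator must choose $p'_y>p_y$ in $\rho_y$ whose time difference from $p_y$ lies in $I$; if he cannot, Spoiler wins. Then Spoiler chooses one of three options. ($\Diamond$ part) The round ends in the configuration given by $p'_x,p'_y$. (Until part) Spoiler chooses $p''_y$ in $\rho_y$ with $p_y<p''_y<p'_y$; Duplicator must choose $p''_x$ in $\rho_x$ with $p_x<p''_x<p'_x$ (if he cannot, Spoiler wins); the round ends in the configuration given by $p''_x,p''_y$. (Counting part) Spoiler chooses one of the two words and places $c$ pebbles at $c$ distinct positions strictly between the current position and the primed position of that word; Duplicator must place $c$ pebbles at $c$ distinct positions strictly between the current and the primed position of the other word; then Spoiler picks a pebbled position in Duplicator's word, and Duplicator picks a pebbled position in Spoiler's word; the round ends in the configuration of these two positions. (2) $\mathsf{C}_I$ round. Spoiler places $c$ pebbles at distinct positions of $\rho_x$ with time stamps in $t+I$, where $t$ is the time stamp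 of $p_x$ in $\rho_x$; Duplicator must place $c$ pebbles at distinct positions of $\rho_y$ with time stamps in $t'+I$, where $t'$ is the time stamp of $p_y$ in $\rho_y$; then Spoiler picks a pebbled position in $\rho_y$ and Duplicator picks a pebbled position in $\rho_x$; the round ends in the configuration of these two positions. Pebbles are returned after each round. Duplicator loses if he cannot make a required move; if Spoiler has no legal move, Duplicator wins. Game equivalence: $(\rho_1,i_1)\approx_{r,k,I_\nu}(\rho_2,j_1)$ iff Duplicator has a winning strategy in the $r$-round $k$-counting-pebble game over $\rho_1,\rho_2$ with intervals $I_\nu$ starting from $(i_1,j_1)$.
   Formalization: In each modality U_{I,η}, η is a Boolean combination of threshold formulae #φ≥n, #φ<n that all share one constant n; with mixed constants game equivalence does not imply formula equivalence, and with only single thresholds the converse fails. -}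

module Defs where

open import Data.Empty using (⊥)
open import Data.Fin.Base as Fin using (Fin; toℕ)
open import Data.Fin.Subset using (Subset; Nonempty; _∈_; ∣_∣)
open import Data.Integer.Base using (+_)
open import Data.Nat.Base as ℕ using (ℕ; zero; suc; _⊔_)
import Data.Nat.Properties as ℕₚ
open import Data.Product.Base using (Σ; Σ-syntax; ∃-syntax; _×_; _,_; proj₁; proj₂)
open import Data.Rational.Base as ℚ using (ℚ; 0ℚ; ½)
import Data.Rational.Properties as ℚₚ
open import Data.Rational.Solver using (module +-*-Solver)
open import Data.Unit.Base using (⊤; tt)
open import Function.Base using (flip)
open import Function.Bundles using (_⇔_)
open import Level using (0ℓ)
open import Relation.Binary.PropositionalEquality using (_≡_; refl; sym; trans; cong; subst)
open import Relation.Nullary.Negation.Core using (¬_)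
open import Relation.Unary using (Pred)

------------------------------------------------------------------------
-- Real numbers: Cauchy sequences of rationals.  Two sequences denote the
-- same real when each is ≤ℝ the other; every notion below depends on
-- time stamps only through _≤ℝ_ and _<ℝ_, which respect this equality.

record ℝ : Set where
  field
    seq    : ℕ → ℚ
    cauchy : ∀ ε → 0ℚ ℚ.< ε →
             ∃[ N ] (∀ m n → N ℕ.≤ m → N ℕ.≤ n → ℚ.∣ seq m ℚ.- seq n ∣ ℚ.≤ ε)

open ℝ public

infix 4 _≤ℝ_ _<ℝ_

_≤ℝ_ : ℝ → ℝ → Set
x ≤ℝ y = ∀ ε → 0ℚ ℚ.< ε → ∃[ N ] (∀ n → N ℕ.≤ n → seq x n ℚ.≤ seq y n ℚ.+ ε)

_<ℝ_ : ℝ → ℝ → Set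
x <ℝ y = ∃[ ε ] 0ℚ ℚ.< ε × ∃[ N ] (∀ n → N ℕ.≤ n → seq x n ℚ.+ ε ℚ.≤ seq y n)

private
  half-pos : ∀ ε → 0ℚ ℚ.< ε → 0ℚ ℚ.< ½ ℚ.* ε
  half-pos ε ε>0 =
    ℚₚ.positive⁻¹ (½ ℚ.* ε) {{ℚₚ.pos*pos⇒pos ½ ε {{ℚ.positive ε>0}}}}

  half+half : ∀ ε → ½ ℚ.* ε ℚ.+ ½ ℚ.* ε ≡ ε
  half+half ε = trans (sym (ℚₚ.*-distribʳ-+ ε ½ ½)) (ℚₚ.*-identityˡ ε)

  regroup : ∀ a b c d → (a ℚ.+ b) ℚ.- (c ℚ.+ d) ≡ (a ℚ.- c) ℚ.+ (b ℚ.- d)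
  regroup = solve 4 (λ a b c d → (a :+ b) :- (c :+ d) := (a :- c) :+ (b :- d)) refl
    where open +-*-Solver

infixl 6 _+ℝ_ _-ℝ_

_+ℝ_ : ℝ → ℝ → ℝ
seq (x +ℝ y) n = seq x n ℚ.+ seq y n
cauchy (x +ℝ y) ε ε>0 = N₁ ⊔ N₂ , close
  where
  N₁ = proj₁ (cauchy x (½ ℚ.* ε) (half-pos ε ε>0))
  N₂ = proj₁ (cauchy y (½ ℚ.* ε) (half-pos ε ε>0))
  close : ∀ m n → N₁ ⊔ N₂ ℕ.≤ m → N₁ ⊔ N₂ ℕ.≤ n →
          ℚ.∣ (seq x m ℚ.+ seq y m) ℚ.- (seq x n ℚ.+ seq y n) ∣ ℚ.≤ ε
  close m n N≤m N≤n = begin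
    ℚ.∣ (seq x m ℚ.+ seq y m) ℚ.- (seq x n ℚ.+ seq y n) ∣
      ≡⟨ cong ℚ.∣_∣ (regroup (seq x m) (seq y m) (seq x n) (seq y n)) ⟩
    ℚ.∣ (seq x m ℚ.- seq x n) ℚ.+ (seq y m ℚ.- seq y n) ∣
      ≤⟨ ℚₚ.∣p+q∣≤∣p∣+∣q∣ (seq x m ℚ.- seq x n) (seq y m ℚ.- seq y n) ⟩
    ℚ.∣ seq x m ℚ.- seq x n ∣ ℚ.+ ℚ.∣ seq y m ℚ.- seq y n ∣
      ≤⟨ ℚₚ.+-mono-≤
           (proj₂ (cauchy x (½ ℚ.* ε) (half-pos ε ε>0)) m n
             (ℕₚ.m⊔n≤o⇒m≤o N₁ N₂ N≤m) (ℕₚ.m⊔n≤o⇒m≤o N₁ N₂ N≤n))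
           (proj₂ (cauchy y (½ ℚ.* ε) (half-pos ε ε>0)) m n
             (ℕₚ.m⊔n≤o⇒n≤o N₁ N₂ N≤m) (ℕₚ.m⊔n≤o⇒n≤o N₁ N₂ N≤n)) ⟩
    ½ ℚ.* ε ℚ.+ ½ ℚ.* ε
      ≡⟨ half+half ε ⟩
    ε ∎
    where open ℚₚ.≤-Reasoning

-ℝ_ : ℝ → ℝ
seq (-ℝ x) n = ℚ.- seq x n
cauchy (-ℝ x) ε ε>0 = proj₁ (cauchy x ε ε>0) , λ m n N≤m N≤n →
  subst (ℚ._≤ ε)
    (trans (sym (ℚₚ.∣-p∣≡∣p∣ (seq x m ℚ.- seq x n)))
           (cong ℚ.∣_∣ (ℚₚ.neg-distrib-+ (seq x m) (ℚ.- seq x n))))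
    (proj₂ (cauchy x ε ε>0) m n N≤m N≤n)

_-ℝ_ : ℝ → ℝ → ℝ
x -ℝ y = x +ℝ (-ℝ y)

fromℕ : ℕ → ℝ
seq (fromℕ n) _ = + n ℚ./ 1
cauchy (fromℕ n) ε ε>0 = 0 , λ _ _ _ _ →
  subst (ℚ._≤ ε) (sym (cong ℚ.∣_∣ (ℚₚ.+-inverseʳ (+ n ℚ./ 1)))) (ℚₚ.<⇒≤ ε>0)

0ℝ : ℝ
0ℝ = fromℕ 0

------------------------------------------------------------------------
-- Intervals

data Endpoint (A : Set) : Set where
  fin : A → Endpoint A
  ∞   : Endpoint A

data Bracket : Set where
  closed open′ : Bracket

record Interval (A : Set) : Set where
  constructor ⟨_,_,_,_⟩
  field
    leftBracket  : Bracket
    left         : Endpoint A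
    right        : Endpoint A
    rightBracket : Bracket

mapEndpoint : ∀ {A B : Set} → (A → B) → Endpoint A → Endpoint B
mapEndpoint f (fin a) = fin (f a)
mapEndpoint f ∞       = ∞

mapInterval : ∀ {A B : Set} → (A → B) → Interval A → Interval B
mapInterval f ⟨ b , l , r , b′ ⟩ = ⟨ b , mapEndpoint f l , mapEndpoint f r , b′ ⟩

embed : Interval ℕ → Interval ℝ
embed = mapInterval fromℕ

_⊕_ : ℝ → Interval ℕ → Interval ℝ
t ⊕ I = mapInterval (t +ℝ_) (embed I)

AboveLeft : Bracket → Endpoint ℝ → ℝ → Set
AboveLeft closed (fin a) t = a ≤ℝ t
AboveLeft open′  (fin a) t = a <ℝ t
AboveLeft _      ∞       t = ⊥

BelowRight : Bracket → Endpoint ℝ → ℝ → Set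
BelowRight closed (fin b) t = t ≤ℝ b
BelowRight open′  (fin b) t = t <ℝ b
BelowRight _      ∞       t = ⊤

infix 4 _∈ᴵ_

_∈ᴵ_ : ℝ → Interval ℝ → Set
t ∈ᴵ ⟨ b , l , r , b′ ⟩ = AboveLeft b l t × BelowRight b′ r t

------------------------------------------------------------------------
-- Timed words over the propositions Fin s

record TimedWord (s : ℕ) : Set where
  field
    length    : ℕ
    σ         : Fin length → Subset s
    σ-nonempty : ∀ i → Nonempty (σ i)
    τ         : Fin length → ℝ
    τ-nonneg  : ∀ i → 0ℝ ≤ℝ τ i
    τ-mono    : ∀ i j → toℕ j ≡ suc (toℕ i) → τ i ≤ℝ τ j

open TimedWord public

dom : ∀ {s} → TimedWord s → Set
dom ρ = Fin (length ρ)

Between : ∀ {n} → Fin n → Fin n → Pred (Fin n) 0ℓ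
Between i j k = (i Fin.< k) × (k Fin.< j)

WithinShift : ∀ {s} (ρ : TimedWord s) → dom ρ → Interval ℕ → Pred (dom ρ) 0ℓ
WithinShift ρ i I k = τ ρ k ∈ᴵ (τ ρ i ⊕ I)

LaterWithin : ∀ {s} (ρ : TimedWord s) → dom ρ → Interval ℕ → Pred (dom ρ) 0ℓ
LaterWithin ρ i I j = (i Fin.< j) × (τ ρ j -ℝ τ ρ i) ∈ᴵ embed I

------------------------------------------------------------------------
-- CTMTL
--
-- A modality U_{I,η} carries one counting constant n, as the round of the
-- game that matches it carries one pebble number; η is a Boolean
-- combination of formulae #φ ≥ n and #φ < n with that n.  Combining
-- thresholds with different constants inside one η would give formulae
-- the game cannot see, since Spoiler fixes the pebble number before
-- Duplicator answers.

mutual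
  data Formula (s : ℕ) : Set where
    atom      : Fin s → Formula s
    true′     : Formula s
    _∧′_      : Formula s → Formula s → Formula s
    ¬′_       : Formula s → Formula s
    C[_]≥_∙_  : Interval ℕ → ℕ → Formula s → Formula s
    _U[_,_]_  : ∀ {n} → Formula s → Interval ℕ → Threshold s n → Formula s → Formula s

  data Threshold (s : ℕ) : ℕ → Set where
    #_≥_ : Formula s → (n : ℕ) → Threshold s n
    #_<_ : Formula s → (n : ℕ) → Threshold s n
    _∧ᵗ_ : ∀ {n} → Threshold s n → Threshold s n → Threshold s n
    ¬ᵗ_  : ∀ {n} → Threshold s n → Threshold s n

-- S = {k | P k}
_Enumerates_ : ∀ {m} → Subset m → Pred (Fin m) 0ℓ → Set
S Enumerates P = ∀ k → k ∈ S ⇔ P k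

Count≥ Count< : ∀ {m} → Pred (Fin m) 0ℓ → ℕ → Set
Count≥ P n = ∃[ S ] S Enumerates P × n ℕ.≤ ∣ S ∣
Count< P n = ∃[ S ] S Enumerates P × ∣ S ∣ ℕ.< n

infix 4 _,_⊨_ _,_,_⊨ᵗ_

mutual
  _,_⊨_ : ∀ {s} (ρ : TimedWord s) → dom ρ → Formula s → Set
  ρ , i ⊨ atom a        = a ∈ σ ρ i
  ρ , i ⊨ true′         = ⊤
  ρ , i ⊨ (φ ∧′ ψ)      = (ρ , i ⊨ φ) × (ρ , i ⊨ ψ)
  ρ , i ⊨ (¬′ φ)        = ¬ (ρ , i ⊨ φ)
  ρ , i ⊨ (C[ I ]≥ n ∙ φ) = Count≥ (λ k → WithinShift ρ i I k × (ρ , k ⊨ φ)) n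
  ρ , i ⊨ (φ U[ I , η ] ψ) =
    ∃[ j ] LaterWithin ρ i I j
         × (ρ , j ⊨ ψ)
         × (∀ k → Between i j k → ρ , k ⊨ φ)
         × (ρ , i , j ⊨ᵗ η)

  _,_,_⊨ᵗ_ : ∀ {s n} (ρ : TimedWord s) → dom ρ → dom ρ → Threshold s n → Set
  ρ , i , j ⊨ᵗ (# φ ≥ n) = Count≥ (λ k → Between i j k × (ρ , k ⊨ φ)) n
  ρ , i , j ⊨ᵗ (# φ < n) = Count< (λ k → Between i j k × (ρ , k ⊨ φ)) n
  ρ , i , j ⊨ᵗ (η ∧ᵗ θ)  = (ρ , i , j ⊨ᵗ η) × (ρ , i , j ⊨ᵗ θ)
  ρ , i , j ⊨ᵗ (¬ᵗ η)    = ¬ (ρ , i , j ⊨ᵗ η)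

mutual
  depth : ∀ {s} → Formula s → ℕ
  depth (atom a)         = 0
  depth true′            = 0
  depth (φ ∧′ ψ)         = depth φ ⊔ depth ψ
  depth (¬′ φ)           = depth φ
  depth (C[ I ]≥ n ∙ φ)  = suc (depth φ)
  depth (φ U[ I , η ] ψ) = suc (depth φ ⊔ depth ψ ⊔ depthᵗ η)

  depthᵗ : ∀ {s n} → Threshold s n → ℕ
  depthᵗ (# φ ≥ n) = depth φ
  depthᵗ (# φ < n) = depth φ
  depthᵗ (η ∧ᵗ θ)  = depthᵗ η ⊔ depthᵗ θ
  depthᵗ (¬ᵗ η)    = depthᵗ η

mutual
  maxConst : ∀ {s} → Formula s → ℕ
  maxConst (atom a)         = 0
  maxConst true′            = 0
  maxConst (φ ∧′ ψ)         = maxConst φ ⊔ maxConst ψ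
  maxConst (¬′ φ)           = maxConst φ
  maxConst (C[ I ]≥ n ∙ φ)  = n ⊔ maxConst φ
  maxConst (φ U[ I , η ] ψ) = maxConst φ ⊔ maxConst ψ ⊔ maxConstᵗ η

  maxConstᵗ : ∀ {s n} → Threshold s n → ℕ
  maxConstᵗ (# φ ≥ n) = n ⊔ maxConst φ
  maxConstᵗ (# φ < n) = n ⊔ maxConst φ
  maxConstᵗ (η ∧ᵗ θ)  = maxConstᵗ η ⊔ maxConstᵗ θ
  maxConstᵗ (¬ᵗ η)    = maxConstᵗ η

mutual
  IntervalsIn : ∀ {s} → Pred (Interval ℕ) 0ℓ → Formula s → Set
  IntervalsIn Iν (atom a)         = ⊤
  IntervalsIn Iν true′            = ⊤
  IntervalsIn Iν (φ ∧′ ψ)         = IntervalsIn Iν φ × IntervalsIn Iν ψ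
  IntervalsIn Iν (¬′ φ)           = IntervalsIn Iν φ
  IntervalsIn Iν (C[ I ]≥ n ∙ φ)  = Iν I × IntervalsIn Iν φ
  IntervalsIn Iν (φ U[ I , η ] ψ) =
    Iν I × IntervalsIn Iν φ × IntervalsIn Iν ψ × IntervalsInᵗ Iν η

  IntervalsInᵗ : ∀ {s n} → Pred (Interval ℕ) 0ℓ → Threshold s n → Set
  IntervalsInᵗ Iν (# φ ≥ n) = IntervalsIn Iν φ
  IntervalsInᵗ Iν (# φ < n) = IntervalsIn Iν φ
  IntervalsInᵗ Iν (η ∧ᵗ θ)  = IntervalsInᵗ Iν η × IntervalsInᵗ Iν θ
  IntervalsInᵗ Iν (¬ᵗ η)    = IntervalsInᵗ Iν η

PointedWord : ℕ → Set
PointedWord s = Σ (TimedWord s) dom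

infix 4 _≡[_,_,_]_ _≈[_,_,_]_

_≡[_,_,_]_ : ∀ {s} → PointedWord s → ℕ → ℕ → Pred (Interval ℕ) 0ℓ → PointedWord s → Set
(ρ₁ , i₁) ≡[ r , k , Iν ] (ρ₂ , j₁) =
  ∀ φ → IntervalsIn Iν φ → depth φ ℕ.≤ r → maxConst φ ℕ.≤ k →
  (ρ₁ , i₁ ⊨ φ) ⇔ (ρ₂ , j₁ ⊨ φ)

------------------------------------------------------------------------
-- Finite two-player games in extensive form.  A player with no legal
-- move loses; `require P g` is lost by Duplicator unless P holds.

data Game : Set₁ where
  won        : Game
  require    : Set → Game → Game
  spoiler    : (Move : Set) → (Move → Game) → Game
  duplicator : (Move : Set) → (Move → Game) → Game

DuplicatorWins : Game → Set
DuplicatorWins won                  = ⊤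
DuplicatorWins (require P g)        = P × DuplicatorWins g
DuplicatorWins (spoiler Move g)     = (m : Move) → DuplicatorWins (g m)
DuplicatorWins (duplicator Move g)  = Σ[ m ∈ Move ] DuplicatorWins (g m)

------------------------------------------------------------------------
-- The CTMTL game

data Word : Set where
  word₁ word₂ : Word

-- relative to the word ρx in which Spoiler opened the round
data Side : Set where
  same other : Side

data Kind : Set where
  U-round C-round : Kind

data Part : Set where
  ◇-part until-part : Part
  counting-part     : Side → Part

-- c pebbles on distinct positions satisfying P
Pebbling : ∀ {m} → ℕ → Pred (Fin m) 0ℓ → Set
Pebbling {m} c P = Σ[ S ∈ Subset m ] (∣ S ∣ ≡ c) × (∀ p → p ∈ S → P p)

Pebbled : ∀ {m c} {P : Pred (Fin m) 0ℓ} → Pebbling c P → Set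
Pebbled {m} (S , _) = Σ[ p ∈ Fin m ] p ∈ S

module _ {s : ℕ} (Iν : Pred (Interval ℕ) 0ℓ) (k : ℕ) where

  -- Spoiler pebbles positions in P, Duplicator answers in Q.
  pebbleExchange : ∀ {m n} → ℕ → Pred (Fin m) 0ℓ → Pred (Fin n) 0ℓ →
                   (Fin m → Fin n → Game) → Game
  pebbleExchange c P Q next =
    spoiler    (Pebbling c P) λ S →
    duplicator (Pebbling c Q) λ D →
    spoiler    (Pebbled D)    λ (q , _) →
    duplicator (Pebbled S)    λ (p , _) →
    next p q

  -- In the rounds below Spoiler has chosen ρx, and pebbles are returned
  -- by continuing with `next` on the new configuration only.

  module _ (ρx ρy : TimedWord s) (px : dom ρx) (py : dom ρy)
           (next : dom ρx → dom ρy → Game) where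

    afterPrimed : ℕ → dom ρx → dom ρy → Part → Game
    afterPrimed c px′ py′ ◇-part = next px′ py′
    afterPrimed c px′ py′ until-part =
      spoiler    (Σ (dom ρy) (Between py py′)) λ (py″ , _) →
      duplicator (Σ (dom ρx) (Between px px′)) λ (px″ , _) →
      next px″ py″
    afterPrimed c px′ py′ (counting-part same) =
      pebbleExchange c (Between px px′) (Between py py′) next
    afterPrimed c px′ py′ (counting-part other) =
      pebbleExchange c (Between py py′) (Between px px′) (flip next)

    roundOf : Kind → Interval ℕ → ℕ → Game
    roundOf U-round I c =
      spoiler    (Σ (dom ρx) (LaterWithin ρx px I)) λ (px′ , _) →
      duplicator (Σ (dom ρy) (LaterWithin ρy py I)) λ (py′ , _) →
      spoiler    Part (afterPrimed c px′ py′)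
    roundOf C-round I c =
      pebbleExchange c (WithinShift ρx px I) (WithinShift ρy py I) next

    round : Game
    round =
      spoiler (Kind × Σ (Interval ℕ) Iν × Σ[ c ∈ ℕ ] c ℕ.≤ k)
              λ (kind , (I , _) , (c , _)) → roundOf kind I c

  module _ (ρ₁ ρ₂ : TimedWord s) where

    isop : dom ρ₁ → dom ρ₂ → Set
    isop i j = σ ρ₁ i ≡ σ ρ₂ j

    game : ℕ → dom ρ₁ → dom ρ₂ → Game
    game zero    i j = require (isop i j) won
    game (suc r) i j = require (isop i j) (spoiler Word λ where
      word₁ → round ρ₁ ρ₂ i j (λ i′ j′ → game r i′ j′)
      word₂ → round ρ₂ ρ₁ j i (λ j′ i′ → game r i′ j′))

_≈[_,_,_]_ : ∀ {s} → PointedWord s → ℕ → ℕ → Pred (Interval ℕ) 0ℓ → PointedWord s → Set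
(ρ₁ , i₁) ≈[ r , k , Iν ] (ρ₂ , j₁) = DuplicatorWins (game Iν k ρ₁ ρ₂ r i₁ j₁)

{-# OPTIONS --safe #-}
module Submission where

-- The two words have finitely many positions, so although Iν may be infinite,
-- finitely many formulae of depth ≤ r separate all inequivalent pairs of
-- positions; their Boolean combinations define sets of positions up to
-- equivalence.  Spoiler's choice of a witness j and pebble number c in a
-- U round is thus described by one formula φ U[ I , η ] ψ: ψ defines j, φ
-- defines the positions before j, and η is the conjunction of finitely many
-- thresholds with constant c that separates the segment up to j from all
-- segments Duplicator must not choose.  Conversely, such a formula is carried
-- along a won game by induction on the formula.

open import Defs
open import Axiom.DoubleNegationElimination using (em⇒dne)
open import Axiom.ExcludedMiddle using (ExcludedMiddle)
open import Data.Bool.Base using (true)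
open import Data.Empty using (⊥-elim)
open import Data.Fin.Base using (Fin; zero; suc)
open import Data.Fin.Subset using (Subset; inside; outside; _∈_; _⊆_; ∣_∣; ⊥)
open import Data.Fin.Subset.Properties using (⊥⊆; ∣⊥∣≡0; out⊆; in⊆in; ⊆-antisym; p⊆q⇒∣p∣≤∣q∣)
open import Data.Nat.Base using (ℕ; zero; suc; _≤_; z≤n; s≤s; _⊔_)
open import Data.Nat.Properties using
  (≤-trans; ≤-reflexive; ⊔-lub; m≤m⊔n; m⊔n≤o⇒m≤o; m⊔n≤o⇒n≤o; ≰⇒>; <⇒≱)
open import Data.Product.Base using (Σ; Σ-syntax; ∃-syntax; _×_; _,_; proj₁; proj₂)
open import Data.Product.Function.NonDependent.Propositional using (_×-⇔_)
open import Data.Unit.Base using (⊤; tt)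
open import Data.Vec.Base using (_∷_; tabulate)
open import Data.Vec.Properties using (lookup∘tabulate; []=⇒lookup; lookup⇒[]=)
open import Function.Base using (flip; _∘_)
open import Function.Bundles using (_⇔_; mk⇔; module Equivalence)
import Function.Properties.Equivalence as ⇔
open import Function.Related.TypeIsomorphisms using (¬-cong-⇔)
open import Level using (0ℓ)
open import Relation.Binary.PropositionalEquality using (_≡_; refl; cong; sym; trans; subst)
open import Relation.Nullary using (¬_; Dec; yes; no; does)
open import Relation.Nullary.Decidable using (dec-true)
open import Relation.Unary using (Pred)

open Equivalence using (to; from)

private
  variable
    m n s c k r : ℕ
    Iν : Pred (Interval ℕ) 0ℓ

-- Counting

-- A formula guarantees at least `c` positions, whereas a round places exactly `c` pebbles; the
-- surplus is dropped.
shrink : ∀ (S : Subset m) c → c ≤ ∣ S ∣ → ∃[ T ] T ⊆ S × ∣ T ∣ ≡ c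
shrink {m} S zero _ = ⊥ , ⊥⊆ , ∣⊥∣≡0 m
shrink (outside ∷ S) (suc c) c≤ with shrink S (suc c) c≤
... | T , T⊆S , ∣T∣≡ = outside ∷ T , out⊆ T⊆S , ∣T∣≡
shrink (inside ∷ S) (suc c) (s≤s c≤) with shrink S c c≤
... | T , T⊆S , ∣T∣≡ = inside ∷ T , in⊆in T⊆S , cong suc ∣T∣≡

count≥⇒pebbling : {P : Pred (Fin m) 0ℓ} → Count≥ P c → Pebbling c P
count≥⇒pebbling {c = c} (S , S≗P , c≤) with shrink S c c≤
... | T , T⊆S , ∣T∣≡c = T , ∣T∣≡c , λ p p∈T → to (S≗P p) (T⊆S p∈T)

module _ (em : ExcludedMiddle 0ℓ) where

  -- Neither comparison of Cauchy reals nor truth of formulae comes with a decision procedure, so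
  -- excluded middle supplies the characteristic vector.
  comprehension : (P : Pred (Fin m) 0ℓ) → ∃[ S ] S Enumerates P
  comprehension P = S , λ p → mk⇔ (member p) (λ Pp →
      lookup⇒[]= p S (trans (lookup∘tabulate _ p) (dec-true em Pp)))
    where
    S : Subset _
    S = tabulate (λ p → does (em {P p}))

    holds : ∀ {A : Set} (A? : Dec A) → does A? ≡ true → A
    holds (yes a) _ = a

    member : ∀ p → p ∈ S → P p
    member p p∈S = holds em (trans (sym (lookup∘tabulate _ p)) ([]=⇒lookup p∈S))

  pebbling⇒count≥ : {P : Pred (Fin m) 0ℓ} → Pebbling c P → Count≥ P c
  pebbling⇒count≥ {P = P} (T , ∣T∣≡c , T⊆P) with comprehension P
  ... | S , S≗P = S , S≗P ,
    ≤-trans (≤-reflexive (sym ∣T∣≡c)) (p⊆q⇒∣p∣≤∣q∣ λ {p} p∈T → from (S≗P p) (T⊆P p p∈T))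

  -- Reduces `# φ < n` to a negated `# φ ≥ n`. Backwards, `Count<` still demands an enumerating set,
  -- which `comprehension` provides.
  count<⇔¬count≥ : (P : Pred (Fin m) 0ℓ) → Count< P c ⇔ (¬ Count≥ P c)
  count<⇔¬count≥ {c = c} P = mk⇔
    (λ (S , S≗P , S<c) (T , T≗P , c≤T) →
      <⇒≱ S<c (≤-trans c≤T (p⊆q⇒∣p∣≤∣q∣ λ {p} → from (S≗P p) ∘ to (T≗P p))))
    (λ ¬≥ → let S , S≗P = comprehension P in S , S≗P , ≰⇒> λ c≤S → ¬≥ (S , S≗P , c≤S))

-- Separation of finitely many models

-- Separation is needed twice, for formulae and for thresholds. Thresholds have no constant for
-- truth, so `some` is an arbitrary sentence from which `top` is built.
record BooleanLogic : Set₁ where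
  infix 4 _⊩_ _≼_
  field
    Model Sentence : Set
    _⊩_   : Model → Sentence → Set
    some  : Sentence
    and   : Sentence → Sentence → Sentence
    not   : Sentence → Sentence
    and-⇔ : ∀ a f g → a ⊩ and f g ⇔ (a ⊩ f × a ⊩ g)
    not-⇔ : ∀ a f → a ⊩ not f ⇔ (¬ a ⊩ f)

  top : Sentence
  top = not (and some (not some))

  ⊩-top : ∀ a → a ⊩ top
  ⊩-top a = from (not-⇔ a _) λ a⊩ → let p , q = to (and-⇔ a _ _) a⊩ in to (not-⇔ a _) q p

  meet : ∀ n (f : Fin n → Sentence) → ∃[ g ] ∀ a → a ⊩ g ⇔ (∀ i → a ⊩ f i)
  meet zero    f = top , λ a → mk⇔ (λ _ ()) (λ _ → ⊩-top a)
  meet (suc n) f with meet n (f ∘ suc)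
  ... | g , g-⇔ = and (f zero) g , λ a → mk⇔
    (λ { a⊩ zero    → proj₁ (to (and-⇔ a _ _) a⊩)
       ; a⊩ (suc i) → to (g-⇔ a) (proj₂ (to (and-⇔ a _ _) a⊩)) i })
    (λ h → from (and-⇔ a _ _) (h zero , from (g-⇔ a) (h ∘ suc)))

  _≼_ : Model → Model → Set
  a ≼ b = ∀ f → a ⊩ f → b ⊩ f

  module _ (em : ExcludedMiddle 0ℓ) where

    private
      dne : ∀ {A : Set} → ¬ ¬ A → A
      dne = em⇒dne em

    -- A sentence true at `b` but false at `a` would have its negation carried from `a` to `b`.
    ≼-sym : ∀ {a b} → a ≼ b → b ≼ a
    ≼-sym {a} {b} a≼b f b⊩f = dne λ a⊮f →
      to (not-⇔ b f) (a≼b (not f) (from (not-⇔ a f) a⊮f)) b⊩f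

    separate : ∀ {a b} → ¬ (a ≼ b) → ∃[ f ] (a ⊩ f × ¬ b ⊩ f)
    separate a⋠b = dne λ ¬∃ → a⋠b λ f a⊩f → dne λ b⊮f → ¬∃ (f , a⊩f , b⊮f)

    module _ (as : Fin n → Model) (P : Pred (Fin n) 0ℓ) where

      -- For each `i` in `P` some sentence is true at `b` and false at `as i`; the negation of their
      -- conjunction works.
      rejects : ∀ b → (∀ i → P i → ¬ (as i ≼ b)) →
                ∃[ f ] (∀ i → P i → as i ⊩ f) × (¬ b ⊩ f)
      rejects b h =
        let g , g-⇔ = meet n (proj₁ ∘ avoid) in
        not g
        , (λ i Pi → from (not-⇔ (as i) g) λ a⊩g →
             proj₂ (proj₂ (avoid i)) Pi (to (g-⇔ (as i)) a⊩g i))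
        , λ b⊩¬g → to (not-⇔ b g) b⊩¬g (from (g-⇔ b) (proj₁ ∘ proj₂ ∘ avoid))
        where
        avoid : ∀ i → ∃[ f ] b ⊩ f × (P i → ¬ as i ⊩ f)
        avoid i with em {P i}
        ... | no ¬Pi = top , ⊩-top b , λ Pi → ⊥-elim (¬Pi Pi)
        ... | yes Pi with separate (h i Pi)
        ...   | f , a⊩f , b⊮f =
          not f , from (not-⇔ b f) b⊮f , λ _ a⊩¬f → to (not-⇔ (as i) f) a⊩¬f a⊩f

      -- There are only finitely many `bs j` to control: conjoin one rejecting sentence for each
      -- that lies above no `as i` in `P`, and `top` for the others. The logic itself may be
      -- infinite.
      isolate : (bs : Fin m → Model) →
                ∃[ f ] (∀ i → P i → as i ⊩ f)
                     × (∀ j → bs j ⊩ f → ∃[ i ] P i × as i ≼ bs j)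
      isolate {m} bs =
        let g , g-⇔ = meet m (proj₁ ∘ single) in
        g , (λ i Pi → from (g-⇔ (as i)) λ j → proj₁ (proj₂ (single j)) i Pi)
          , (λ j b⊩g → proj₂ (proj₂ (single j)) (to (g-⇔ (bs j)) b⊩g j))
        where
        single : ∀ j → ∃[ f ] (∀ i → P i → as i ⊩ f)
                            × (bs j ⊩ f → ∃[ i ] P i × as i ≼ bs j)
        single j with em {∃[ i ] P i × as i ≼ bs j}
        ... | yes found = top , (λ i _ → ⊩-top (as i)) , λ _ → found
        ... | no ¬found with rejects (bs j) (λ i Pi a≼b → ¬found (i , Pi , a≼b))
        ...   | f , P⊆f , b⊮f = f , P⊆f , λ b⊩f → ⊥-elim (b⊮f b⊩f)

-- Formulae and thresholds visible to the game

Permitted : Pred (Interval ℕ) 0ℓ → ℕ → ℕ → Pred (Formula s) 0ℓ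
Permitted Iν r k φ = IntervalsIn Iν φ × depth φ ≤ r × maxConst φ ≤ k

Permittedᵗ : Pred (Interval ℕ) 0ℓ → ℕ → ℕ → Pred (Threshold s n) 0ℓ
Permittedᵗ Iν r k η = IntervalsInᵗ Iν η × depthᵗ η ≤ r × maxConstᵗ η ≤ k

-- Makes the index of `η` a legal pebble number. Every leaf carries the index as its constant, so
-- following one branch suffices.
index≤maxConstᵗ : (η : Threshold s n) → n ≤ maxConstᵗ η
index≤maxConstᵗ (# φ ≥ n) = m≤m⊔n n (maxConst φ)
index≤maxConstᵗ (# φ < n) = m≤m⊔n n (maxConst φ)
index≤maxConstᵗ (η ∧ᵗ θ)  = ≤-trans (index≤maxConstᵗ η) (m≤m⊔n _ _)
index≤maxConstᵗ (¬ᵗ η)    = index≤maxConstᵗ η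

formulaLogic : ℕ → Pred (Interval ℕ) 0ℓ → ℕ → ℕ → BooleanLogic
formulaLogic s Iν r k = record
  { Model    = PointedWord s
  ; Sentence = Σ (Formula s) (Permitted Iν r k)
  ; _⊩_      = λ (ρ , i) (φ , _) → ρ , i ⊨ φ
  ; some     = true′ , tt , z≤n , z≤n
  ; and      = λ (φ , i₁ , d₁ , c₁) (ψ , i₂ , d₂ , c₂) →
                 φ ∧′ ψ , (i₁ , i₂) , ⊔-lub d₁ d₂ , ⊔-lub c₁ c₂
  ; not      = λ (φ , ok) → ¬′ φ , ok
  ; and-⇔    = λ _ _ _ → ⇔.refl
  ; not-⇔    = λ _ _ → ⇔.refl
  }

Segment : ℕ → Set
Segment s = Σ[ ρ ∈ TimedWord s ] dom ρ × dom ρ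

thresholdLogic : ∀ s → Pred (Interval ℕ) 0ℓ → ℕ → (k c : ℕ) → c ≤ k → BooleanLogic
thresholdLogic s Iν r k c c≤k = record
  { Model    = Segment s
  ; Sentence = Σ (Threshold s c) (Permittedᵗ Iν r k)
  ; _⊩_      = λ (ρ , i , j) (η , _) → ρ , i , j ⊨ᵗ η
  ; some     = # true′ ≥ c , tt , z≤n , ⊔-lub c≤k z≤n
  ; and      = λ (η , i₁ , d₁ , c₁) (θ , i₂ , d₂ , c₂) →
                 η ∧ᵗ θ , (i₁ , i₂) , ⊔-lub d₁ d₂ , ⊔-lub c₁ c₂
  ; not      = λ (η , ok) → ¬ᵗ η , ok
  ; and-⇔    = λ _ _ _ → ⇔.refl
  ; not-⇔    = λ _ _ → ⇔.refl
  }

≡-sym : {x y : PointedWord s} → x ≡[ r , k , Iν ] y → y ≡[ r , k , Iν ] x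
≡-sym x≡y φ i d c = ⇔.sym (x≡y φ i d c)

module _ (em : ExcludedMiddle 0ℓ) where

  ≼⇒≡ : {x y : PointedWord s} → BooleanLogic._≼_ (formulaLogic s Iν r k) x y →
        x ≡[ r , k , Iν ] y
  ≼⇒≡ {x = x} {y} x≼y φ i d c = mk⇔ (x≼y (φ , i , d , c))
    (BooleanLogic.≼-sym (formulaLogic _ _ _ _) em {x} {y} x≼y (φ , i , d , c))

  definingFormula : ∀ Iν r k (ρx ρy : TimedWord s) (P : Pred (dom ρx) 0ℓ) →
    ∃[ φ ] Permitted Iν r k φ
         × (∀ p → P p → ρx , p ⊨ φ)
         × (∀ q → ρy , q ⊨ φ → ∃[ p ] P p × ((ρx , p) ≡[ r , k , Iν ] (ρy , q)))
  definingFormula Iν r k ρx ρy P =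
    let (φ , ok) , P⊆φ , φ⊆P =
          BooleanLogic.isolate (formulaLogic _ Iν r k) em (ρx ,_) P (ρy ,_)
    in φ , ok , P⊆φ , λ q q⊨φ → let p , Pp , p≼q = φ⊆P q q⊨φ in p , Pp , ≼⇒≡ p≼q

  -- With `py` fixed, the candidate segments are finitely many, one for each `py′`, so `isolate`
  -- applies to the single model `ρx , px , px′`. Agreement concerns the constant `c` only, which is
  -- all that a counting part with `c` pebbles tests.
  definingThreshold : ∀ Iν r k {c} → c ≤ k →
    (ρx ρy : TimedWord s) (px px′ : dom ρx) (py : dom ρy) →
    Σ[ η ∈ Threshold s c ] Permittedᵗ Iν r k η
         × (ρx , px , px′ ⊨ᵗ η)
         × (∀ py′ → ρy , py , py′ ⊨ᵗ η → ∀ (θ : Threshold s c) → Permittedᵗ Iν r k θ →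
              (ρx , px , px′ ⊨ᵗ θ) ⇔ (ρy , py , py′ ⊨ᵗ θ))
  definingThreshold Iν r k c≤k ρx ρy px px′ py =
    let open BooleanLogic (thresholdLogic _ Iν r k _ c≤k)
        (η , ok) , x⊨η , η⊆ = isolate em {n = 1}
          (λ _ → ρx , px , px′) (λ _ → ⊤) (λ py′ → ρy , py , py′)
    in η , ok , x⊨η zero tt , λ py′ y⊨η θ θ-ok →
         let _ , _ , x≼y = η⊆ py′ y⊨η
         in mk⇔ (x≼y (θ , θ-ok)) (≼-sym em x≼y (θ , θ-ok))

-- From strategies to formulae

  -- Spoiler pebbles `c` positions in `A`. Since he may then pick any pebble `q` of Duplicator, each
  -- `q` has an answer `p` in `A`, which forces `q` into `B`.
  exchange-count : ∀ s Iν k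
    {P : Pred (Fin m) 0ℓ} {Q : Pred (Fin n) 0ℓ} {next : Fin m → Fin n → Game}
    {A : Pred (Fin m) 0ℓ} {B : Pred (Fin n) 0ℓ} →
    DuplicatorWins (pebbleExchange {s} Iν k c P Q next) →
    (∀ p q → DuplicatorWins (next p q) → A p → B q) →
    Count≥ (λ p → P p × A p) c → Count≥ (λ q → Q q × B q) c
  exchange-count _ _ _ win A⇒B count with count≥⇒pebbling count
  ... | S , ∣S∣≡c , S⊆ with win (S , ∣S∣≡c , λ p → proj₁ ∘ S⊆ p)
  ... | (D , ∣D∣≡c , D⊆) , answer = pebbling⇒count≥ em (D , ∣D∣≡c , λ q q∈D →
    let (p , p∈S) , w = answer (q , q∈D) in D⊆ q q∈D , A⇒B p q w (proj₂ (S⊆ p p∈S)))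

  -- Each conjunct at the witness is tested by one part of the round. `η` receives exchanges in both
  -- directions because its negations reverse the transfer.
  U-round-transfer : ∀ Iν k
    (ρx ρy : TimedWord s) {px : dom ρx} {py : dom ρy} {next : dom ρx → dom ρy → Game}
    (φ ψ : Formula s) (η : Threshold s c) {I : Interval ℕ} →
    DuplicatorWins (roundOf Iν k ρx ρy px py next U-round I c) →
    (∀ p q → DuplicatorWins (next p q) → ρx , p ⊨ φ → ρy , q ⊨ φ) →
    (∀ p q → DuplicatorWins (next p q) → ρx , p ⊨ ψ → ρy , q ⊨ ψ) →
    (∀ px′ py′ →
      DuplicatorWins (pebbleExchange {s} Iν k c (Between px px′) (Between py py′) next) →
      DuplicatorWins (pebbleExchange {s} Iν k c (Between py py′) (Between px px′) (flip next)) →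
      ρx , px , px′ ⊨ᵗ η → ρy , py , py′ ⊨ᵗ η) →
    ρx , px ⊨ (φ U[ I , η ] ψ) → ρy , py ⊨ (φ U[ I , η ] ψ)
  U-round-transfer _ _ ρx ρy φ ψ η win on-φ on-ψ on-η (px′ , later , ψ-holds , φ-holds , η-holds)
    with win (px′ , later)
  ... | (py′ , later′) , parts = py′ , later′
    , on-ψ px′ py′ (parts ◇-part) ψ-holds
    , (λ q between → let (p , between′) , w = parts until-part (q , between)
                     in on-φ p q w (φ-holds p between′))
    , on-η px′ py′ (parts (counting-part same)) (parts (counting-part other)) η-holds

  module _ (ρ₁ ρ₂ : TimedWord s) (Iν : Pred (Interval ℕ) 0ℓ) (k : ℕ) where

    private
      Wins : ℕ → dom ρ₁ → dom ρ₂ → Set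
      Wins r i j = DuplicatorWins (game Iν k ρ₁ ρ₂ r i j)

      SegmentGame : ℕ → ℕ → (i i′ : dom ρ₁) (j j′ : dom ρ₂) → Set
      SegmentGame r n i i′ j j′ =
        DuplicatorWins (pebbleExchange {s} Iν k n (Between i i′) (Between j j′)
                          (game Iν k ρ₁ ρ₂ r)) ×
        DuplicatorWins (pebbleExchange {s} Iν k n (Between j j′) (Between i i′)
                          (flip (game Iν k ρ₁ ρ₂ r)))

    win⇒isop : ∀ r {i j} → Wins r i j → σ ρ₁ i ≡ σ ρ₂ j
    win⇒isop zero    (e , _) = e
    win⇒isop (suc r) (e , _) = e

    mutual
      -- Negation requires equivalences in the induction; for a modality, opening in `word₁` gives
      -- one direction and opening in `word₂` the other.
      transfer : ∀ φ r {i j} → Permitted Iν r k φ → Wins r i j → (ρ₁ , i ⊨ φ) ⇔ (ρ₂ , j ⊨ φ)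
      transfer (atom a) r _ w = mk⇔ (subst (a ∈_) (win⇒isop r w)) (subst (a ∈_) (sym (win⇒isop r w)))
      transfer true′ r _ w = ⇔.refl
      transfer (φ ∧′ ψ) r ((i₁ , i₂) , d , c) w =
        transfer φ r (i₁ , m⊔n≤o⇒m≤o _ _ d , m⊔n≤o⇒m≤o _ _ c) w ×-⇔
        transfer ψ r (i₂ , m⊔n≤o⇒n≤o _ _ d , m⊔n≤o⇒n≤o _ _ c) w
      transfer (¬′ φ) r ok w = ¬-cong-⇔ (transfer φ r ok w)
      transfer (C[ I ]≥ n ∙ φ) (suc r) ((I∈ , i) , s≤s d , c) (_ , w) = mk⇔
        (exchange-count s Iν k (w word₁ move) (λ _ _ → to ∘ on-φ))
        (exchange-count s Iν k (w word₂ move) (λ _ _ → from ∘ on-φ))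
        where
        move = C-round , (I , I∈) , n , m⊔n≤o⇒m≤o _ _ c
        on-φ : ∀ {p q} → Wins r p q → _
        on-φ = transfer φ r (i , d , m⊔n≤o⇒n≤o _ _ c)
      transfer (_U[_,_]_ {n} φ I η ψ) (suc r) ((I∈ , iφ , iψ , iη) , s≤s d , c) (_ , w) = mk⇔
        (U-round-transfer Iν k ρ₁ ρ₂ φ ψ η (w word₁ move) (λ _ _ → to ∘ on-φ) (λ _ _ → to ∘ on-ψ)
          (λ _ _ e f → to (on-η (e , f))))
        (U-round-transfer Iν k ρ₂ ρ₁ φ ψ η (w word₂ move) (λ _ _ → from ∘ on-φ) (λ _ _ → from ∘ on-ψ)
          (λ _ _ e f → from (on-η (f , e))))
        where
        cη = m⊔n≤o⇒n≤o (maxConst φ ⊔ maxConst ψ) _ c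
        move = U-round , (I , I∈) , n , ≤-trans (index≤maxConstᵗ η) cη
        dφψ = m⊔n≤o⇒m≤o (depth φ ⊔ depth ψ) _ d
        cφψ = m⊔n≤o⇒m≤o (maxConst φ ⊔ maxConst ψ) _ c
        on-φ : ∀ {p q} → Wins r p q → _
        on-φ = transfer φ r (iφ , m⊔n≤o⇒m≤o _ _ dφψ , m⊔n≤o⇒m≤o _ _ cφψ)
        on-ψ : ∀ {p q} → Wins r p q → _
        on-ψ = transfer ψ r (iψ , m⊔n≤o⇒n≤o _ _ dφψ , m⊔n≤o⇒n≤o _ _ cφψ)
        on-η : ∀ {i i′ j j′} → SegmentGame r n i i′ j j′ → _
        on-η = transferᵗ η r (iη , m⊔n≤o⇒n≤o (depth φ ⊔ depth ψ) _ d , cη)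

      transfer-count : ∀ φ r {n i i′ j j′} → Permitted Iν r k φ →
        SegmentGame r n i i′ j j′ →
        Count≥ (λ p → Between i i′ p × (ρ₁ , p ⊨ φ)) n ⇔
        Count≥ (λ q → Between j j′ q × (ρ₂ , q ⊨ φ)) n
      transfer-count φ r ok (e , f) = mk⇔
        (exchange-count s Iν k e (λ _ _ → to ∘ transfer φ r ok))
        (exchange-count s Iν k f (λ _ _ → from ∘ transfer φ r ok))

      transferᵗ : ∀ (η : Threshold s n) r {i i′ j j′} → Permittedᵗ Iν r k η →
        SegmentGame r n i i′ j j′ → (ρ₁ , i , i′ ⊨ᵗ η) ⇔ (ρ₂ , j , j′ ⊨ᵗ η)
      transferᵗ (# φ ≥ n) r (i , d , c) g =
        transfer-count φ r (i , d , m⊔n≤o⇒n≤o _ _ c) g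
      transferᵗ (# φ < n) r (i , d , c) g =
        ⇔.trans (count<⇔¬count≥ em _)
          (⇔.trans (¬-cong-⇔ (transfer-count φ r (i , d , m⊔n≤o⇒n≤o _ _ c) g))
                   (⇔.sym (count<⇔¬count≥ em _)))
      transferᵗ (η ∧ᵗ θ) r ((i₁ , i₂) , d , c) g =
        transferᵗ η r (i₁ , m⊔n≤o⇒m≤o _ _ d , m⊔n≤o⇒m≤o _ _ c) g ×-⇔
        transferᵗ θ r (i₂ , m⊔n≤o⇒n≤o _ _ d , m⊔n≤o⇒n≤o _ _ c) g
      transferᵗ (¬ᵗ η) r ok g = ¬-cong-⇔ (transferᵗ η r ok g)

-- From formulae to strategies

  -- Duplicator pebbles `c` positions satisfying a formula that defines `S` up to equivalence, so
  -- whichever one Spoiler picks has an equivalent position in `S` to answer with.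
  exchange-win :
    (ρx ρy : TimedWord s) {P : Pred (dom ρx) 0ℓ} {Q : Pred (dom ρy) 0ℓ}
    {next : dom ρx → dom ρy → Game} →
    (∀ p q → (ρx , p) ≡[ r , k , Iν ] (ρy , q) → DuplicatorWins (next p q)) →
    (∀ φ → Permitted Iν r k φ →
      Count≥ (λ p → P p × (ρx , p ⊨ φ)) c → Count≥ (λ q → Q q × (ρy , q ⊨ φ)) c) →
    DuplicatorWins (pebbleExchange {s} Iν k c P Q next)
  exchange-win {r = r} {k} {Iν} ρx ρy ≡⇒win count (S , ∣S∣≡c , S⊆P)
    with definingFormula Iν r k ρx ρy (_∈ S)
  ... | φ , ok , S⊆φ , φ⊆S
    with count≥⇒pebbling (count φ ok
           (pebbling⇒count≥ em (S , ∣S∣≡c , λ p p∈S → S⊆P p p∈S , S⊆φ p p∈S)))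
  ... | D , ∣D∣≡c , D⊆ = (D , ∣D∣≡c , λ q → proj₁ ∘ D⊆ q) , λ (q , q∈D) →
    let p , p∈S , p≡q = φ⊆S q (proj₂ (D⊆ q q∈D)) in (p , p∈S) , ≡⇒win p q p≡q

  round-win :
    (ρx ρy : TimedWord s) {px : dom ρx} {py : dom ρy} {next : dom ρx → dom ρy → Game} →
    (∀ p q → (ρx , p) ≡[ r , k , Iν ] (ρy , q) → DuplicatorWins (next p q)) →
    (ρx , px) ≡[ suc r , k , Iν ] (ρy , py) →
    DuplicatorWins (round Iν k ρx ρy px py next)
  round-win ρx ρy ≡⇒win x≡y (C-round , (I , I∈) , c , c≤k) =
    exchange-win ρx ρy ≡⇒win λ φ (i , d , m) →
      to (x≡y (C[ I ]≥ c ∙ φ) (I∈ , i) (s≤s d) (⊔-lub c≤k m))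
  round-win {r = r} {k} {Iν} ρx ρy {px} {py} ≡⇒win x≡y (U-round , (I , I∈) , c , c≤k) (px′ , later)
    with definingFormula Iν r k ρx ρy (Between px px′)
       -- The singleton predicate makes `ψ` hold in `ρy` only at positions equivalent to `px′`,
       -- which settles the diamond part.
       | definingFormula Iν r k ρx ρy (_≡ px′)
       | definingThreshold Iν r k c≤k ρx ρy px px′ py
  ... | φ , (iφ , dφ , cφ) , between⊆φ , φ⊆between
      | ψ , (iψ , dψ , cψ) , at⊆ψ , ψ⊆at
      | η , (iη , dη , cη) , η-holds , η⇒≡
    with to (x≡y (φ U[ I , η ] ψ) (I∈ , iφ , iψ , iη)
                 (s≤s (⊔-lub (⊔-lub dφ dψ) dη)) (⊔-lub (⊔-lub cφ cψ) cη))
            (px′ , later , at⊆ψ px′ refl , between⊆φ , η-holds)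
  ... | py′ , later′ , ψ-holds , φ-holds , η-holds′ = (py′ , later′) , λ where
      ◇-part → case-◇ (ψ⊆at py′ ψ-holds)
      until-part (q , between) →
        let p , between′ , p≡q = φ⊆between q (φ-holds q between) in (p , between′) , ≡⇒win p q p≡q
      (counting-part same) → exchange-win ρx ρy ≡⇒win λ χ (i , d , m) →
        to (η⇒≡ py′ η-holds′ (# χ ≥ c) (i , d , ⊔-lub c≤k m))
      -- Spoiler now pebbles `ρy`, so counts travel back to `ρx`; this uses the converse half of the
      -- agreement on thresholds.
      (counting-part other) → exchange-win ρy ρx (λ q p q≡p → ≡⇒win p q (≡-sym q≡p)) λ χ (i , d , m) →
        from (η⇒≡ py′ η-holds′ (# χ ≥ c) (i , d , ⊔-lub c≤k m))
    where
    case-◇ : ∃[ p ] p ≡ px′ × ((ρx , p) ≡[ r , k , Iν ] (ρy , py′)) → _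
    case-◇ (_ , refl , p≡q) = ≡⇒win px′ py′ p≡q

  -- Atoms have depth and constant 0, so they are compared for every `r` and `k`.
  ≡⇒isop : (ρ₁ ρ₂ : TimedWord s) {i : dom ρ₁} {j : dom ρ₂} →
           (ρ₁ , i) ≡[ r , k , Iν ] (ρ₂ , j) → σ ρ₁ i ≡ σ ρ₂ j
  ≡⇒isop _ _ i≡j = ⊆-antisym (λ {a} → to (i≡j (atom a) tt z≤n z≤n))
                             (λ {a} → from (i≡j (atom a) tt z≤n z≤n))

  ≡⇒≈ : (ρ₁ ρ₂ : TimedWord s) (r : ℕ) {i : dom ρ₁} {j : dom ρ₂} →
        (ρ₁ , i) ≡[ r , k , Iν ] (ρ₂ , j) → (ρ₁ , i) ≈[ r , k , Iν ] (ρ₂ , j)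
  ≡⇒≈ ρ₁ ρ₂ zero    i≡j = ≡⇒isop ρ₁ ρ₂ i≡j , tt
  ≡⇒≈ ρ₁ ρ₂ (suc r) i≡j = ≡⇒isop ρ₁ ρ₂ i≡j , λ where
    word₁ → round-win ρ₁ ρ₂ (λ _ _ → ≡⇒≈ ρ₁ ρ₂ r) i≡j
    word₂ → round-win ρ₂ ρ₁ (λ _ _ q≡p → ≡⇒≈ ρ₁ ρ₂ r (≡-sym q≡p)) (≡-sym i≡j)

theorem4 : ExcludedMiddle 0ℓ →
    ∀ {s} (ρ₁ ρ₂ : TimedWord s) (i₁ : dom ρ₁) (j₁ : dom ρ₂)
    (r k : ℕ) (Iν : Pred (Interval ℕ) 0ℓ) →
    ((ρ₁ , i₁) ≈[ r , k , Iν ] (ρ₂ , j₁)) ⇔ ((ρ₁ , i₁) ≡[ r , k , Iν ] (ρ₂ , j₁))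
theorem4 em ρ₁ ρ₂ i₁ j₁ r k Iν = mk⇔
  (λ win φ i d c → transfer em ρ₁ ρ₂ Iν k φ r (i , d , c) win)
  (≡⇒≈ em ρ₁ ρ₂ r)
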